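{- For any graph $G$: (i) $ct_{\gamma_{t2}}(G) = 1$ if and only if there exists a minimum semitotal dominating set $D$ of $G$ such that $D$ contains a friendly triple. (ii) $ct_{\gamma_{t2}}(G) = 2$ if and only if no minimum semitotal dominating set of $G$ contains a friendly triple and there exists a semitotal dominating set of $G$ of size $\gamma_{t2}(G) + 1$ that contains an ST-configuration.
   Context: All graphs are finite, simple and connected; $d_G(u,v)$ is the distance in $G$. A semitotal dominating set of $G$ is a set $D\subseteq V(G)$ such that every vertex of $V(G)\setminus D$ has a neighbour in $D$ and every vertex of $D$ is at distance at most two from some other vertex of $D$; $\gamma_{t2}(G)$ is the minimum size of such a set, and a minimum semitotal dominating set is one of this size. Contracting an edge $uv$ means deleting $u,v$ and adding a new vertex adjacent to every neighbour of $u$ or $v$; $ct_{\gamma_{t2}}(G)$ is the smallest $k$ such that contracting some $k$ edges of $G$ yields a graph $G'$ with $\gamma_{t2}(G')<\gamma_{t2}(G)$. A friendly triple is a set of three distinct vertices $x,y,z$ with $xy\in E(G)$ and $d_G(y,z)\leq 2$. A set $S$ contains an ST-configuration if $S$ contains distinct vertices forming one of the following (other edges among them may also be present): (O1) $a,b,c,d,e,f$ with $ab,bc,de,ef\in E(G)$; (O2) $a,b,c,d,e,f$ with $ab,de,ef\in E(G)$ and $d_G(b,c)=2$; (O3) $a,b,c,d,e,f$ with $ab,de\in E(G)$, $d_G(b,c)=2$ and $d_G(e,f)=2$, where $c$ and $f$ are allowed to be the same vertex (all other listed vertices distinct); (O4) $a,b,c,d$ with $ab,ac,ad\in E(G)$;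 (O5) $a,b,c,d$ with $ab,bc\in E(G)$ and $d_G(c,d)=2$; (O6) $a,b,c,d$ with $ab,bd\in E(G)$ and $d_G(b,c)=2$; (O7) $a,b,c,d$ with $ab,cd\in E(G)$ and $d_G(b,c)=2$. -}

module Defs where

open import Data.Empty using (⊥)
open import Data.Fin using (Fin; zero; suc; punchIn; punchOut)
open import Data.Fin.Subset using (Subset; _∈_; _∉_; ∣_∣)
open import Data.List using ([]; _∷_)
open import Data.List.Relation.Unary.All using (All)
open import Data.List.Relation.Unary.Unique.Propositional using (Unique)
open import Data.Nat using (ℕ; suc; _+_; _≤_; _<_)
open import Data.Product using (_×_; ∃-syntax)
open import Data.Sum using (_⊎_)
open import Level using (Level)
open import Relation.Binary.Definitions using (Decidable; Symmetric)
open import Relation.Binary.PropositionalEquality using (_≡_; _≢_; refl)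
open import Relation.Nullary using (¬_; no)
open import Relation.Nullary.Decidable using (_⊎-dec_)

record Graph (n : ℕ) : Set₁ where
  field
    Adj    : Fin n → Fin n → Set
    adj?   : Decidable Adj
    sym    : Symmetric Adj
    irrefl : ∀ {u} → ¬ Adj u u

  adj⇒≢ : ∀ {u v} → Adj u v → u ≢ v
  adj⇒≢ e refl = irrefl e

open Graph public using (Adj; adj⇒≢)

IsLeast : ∀ {ℓ : Level} → (ℕ → Set ℓ) → ℕ → Set ℓ
IsLeast P k = P k × (∀ j → P j → k ≤ j)

module _ {n : ℕ} (G : Graph n) where

  data Walk : Fin n → Fin n → ℕ → Set where
    []  : ∀ {u} → Walk u u 0
    _∷_ : ∀ {u v w k} → Adj G u v → Walk v w k → Walk u w (suc k)

  Connected : Set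
  Connected = ∀ u v → ∃[ k ] Walk u v k

  -- Distance is a functional relation:  Dist u v k  reads  d(u,v) = k.
  Dist : Fin n → Fin n → ℕ → Set
  Dist u v = IsLeast (Walk u v)

  Dist≤ : Fin n → Fin n → ℕ → Set
  Dist≤ u v m = ∃[ k ] (Dist u v k × k ≤ m)

  record SemitotalDominating (D : Subset n) : Set where
    field
      dominating : ∀ v → v ∉ D → ∃[ w ] (w ∈ D × Adj G v w)
      semitotal  : ∀ v → v ∈ D → ∃[ w ] (w ∈ D × w ≢ v × Dist≤ v w 2)

  -- γt2 k  reads  γ_{t2}(G) = k.  It holds for no k when G has no semitotal
  -- dominating set, which for a connected graph means that G is K₁.
  γt2 : ℕ → Set
  γt2 = IsLeast (λ k → ∃[ D ] (SemitotalDominating D × ∣ D ∣ ≡ k))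

  MinSemitotalDominating : Subset n → Set
  MinSemitotalDominating D = SemitotalDominating D × γt2 ∣ D ∣

  ContainsFriendlyTriple : Subset n → Set
  ContainsFriendlyTriple S =
    ∃[ x ] ∃[ y ] ∃[ z ]
      (Unique (x ∷ y ∷ z ∷ []) × All (_∈ S) (x ∷ y ∷ z ∷ []) ×
       Adj G x y × Dist≤ y z 2)

  data ContainsSTConfiguration (S : Subset n) : Set where

    O1 : ∀ a b c d e f →
         Unique (a ∷ b ∷ c ∷ d ∷ e ∷ f ∷ []) →
         All (_∈ S) (a ∷ b ∷ c ∷ d ∷ e ∷ f ∷ []) →
         Adj G a b → Adj G b c → Adj G d e → Adj G e f →
         ContainsSTConfiguration S

    O2 : ∀ a b c d e f →
         Unique (a ∷ b ∷ c ∷ d ∷ e ∷ f ∷ []) →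
         All (_∈ S) (a ∷ b ∷ c ∷ d ∷ e ∷ f ∷ []) →
         Adj G a b → Adj G d e → Adj G e f → Dist b c 2 →
         ContainsSTConfiguration S

    -- The two Unique hypotheses separate every pair of vertices except c, f.
    O3 : ∀ a b c d e f →
         Unique (a ∷ b ∷ c ∷ d ∷ e ∷ []) →
         Unique (a ∷ b ∷ d ∷ e ∷ f ∷ []) →
         All (_∈ S) (a ∷ b ∷ c ∷ d ∷ e ∷ f ∷ []) →
         Adj G a b → Adj G d e → Dist b c 2 → Dist e f 2 →
         ContainsSTConfiguration S

    O4 : ∀ a b c d →
         Unique (a ∷ b ∷ c ∷ d ∷ []) →
         All (_∈ S) (a ∷ b ∷ c ∷ d ∷ []) →
         Adj G a b → Adj G a c → Adj G a d →
         ContainsSTConfiguration S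

    O5 : ∀ a b c d →
         Unique (a ∷ b ∷ c ∷ d ∷ []) →
         All (_∈ S) (a ∷ b ∷ c ∷ d ∷ []) →
         Adj G a b → Adj G b c → Dist c d 2 →
         ContainsSTConfiguration S

    O6 : ∀ a b c d →
         Unique (a ∷ b ∷ c ∷ d ∷ []) →
         All (_∈ S) (a ∷ b ∷ c ∷ d ∷ []) →
         Adj G a b → Adj G b d → Dist b c 2 →
         ContainsSTConfiguration S

    O7 : ∀ a b c d →
         Unique (a ∷ b ∷ c ∷ d ∷ []) →
         All (_∈ S) (a ∷ b ∷ c ∷ d ∷ []) →
         Adj G a b → Adj G c d → Dist b c 2 →
         ContainsSTConfiguration S

-- Contraction of the edge uv: vertex zero of the result is the new vertex, and
-- suc i is the vertex  old i  of G, where old enumerates V(G) ∖ {u, v}.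
module _ {n : ℕ} (G : Graph (2 + n)) {u v : Fin (2 + n)} (uv : Adj G u v) where

  old : Fin n → Fin (2 + n)
  old i = punchIn u (punchIn (punchOut (adj⇒≢ G uv)) i)

  ContractAdj : Fin (suc n) → Fin (suc n) → Set
  ContractAdj zero    zero    = ⊥
  ContractAdj zero    (suc j) = Adj G u (old j) ⊎ Adj G v (old j)
  ContractAdj (suc i) zero    = Adj G u (old i) ⊎ Adj G v (old i)
  ContractAdj (suc i) (suc j) = Adj G (old i) (old j)

  contract : Graph (suc n)
  contract = record
    { Adj    = ContractAdj
    ; adj?   = dec
    ; sym    = λ {i} {j} → symm i j
    ; irrefl = λ {i} → irr i
    }
    where
    dec : Decidable ContractAdj
    dec zero    zero    = no λ ()
    dec zero    (suc j) = Graph.adj? G u (old j) ⊎-dec Graph.adj? G v (old j)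
    dec (suc i) zero    = Graph.adj? G u (old i) ⊎-dec Graph.adj? G v (old i)
    dec (suc i) (suc j) = Graph.adj? G (old i) (old j)

    symm : ∀ i j → ContractAdj i j → ContractAdj j i
    symm zero    (suc j) p = p
    symm (suc i) zero    p = p
    symm (suc i) (suc j) p = Graph.sym G p

    irr : ∀ i → ¬ ContractAdj i i
    irr (suc i) p = Graph.irrefl G p

-- Contracts k G H: H arises from G by contracting k edges, one after another.
-- The least k for which a given H is reached is the same as for simultaneous
-- contraction of a set of k edges of G: a smallest such set is acyclic, so no
-- edge of it becomes a loop or merges with another while the rest are contracted.
data Contracts : ℕ → ∀ {n m} → Graph n → Graph m → Set₁ where
  done : ∀ {n} {G : Graph n} → Contracts 0 G G
  step : ∀ {k n m} {G : Graph (2 + n)} {H : Graph m} {u v} (uv : Adj G u v) →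
         Contracts k (contract G uv) H → Contracts (suc k) G H

_<γt2_ : ∀ {m n} → Graph m → Graph n → Set
H <γt2 G = ∃[ h ] ∃[ g ] (γt2 H h × γt2 G g × h < g)

-- ct G k  reads  ct_{γt2}(G) = k;  it holds for no k when no sequence of
-- contractions lowers γ_{t2}.
ct : ∀ {n} → Graph n → ℕ → Set₁
ct G = IsLeast (λ k → ∃[ m ] ∃[ H ] (Contracts k {m = m} G H × H <γt2 G))

{-# OPTIONS --safe #-}
module Submission where

-- Contracting an edge xy inside a semitotal dominating set D, with a third
-- vertex of D within distance two of x or y, maps D onto a semitotal dominating
-- set with one vertex fewer.  Conversely, let D′ be a semitotal dominating set of
-- G/uv.  Replacing the new vertex by u and v if it lies in D′, or adding an end of
-- uv adjacent to D′ otherwise, gives a semitotal dominating set of G with one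
-- vertex more, and it contains a friendly triple.  This yields (i).  For (ii) both
-- steps are iterated: the configurations O1-O7 are exactly the ways in which D can
-- contain two such edges to contract in turn, either sharing a vertex or disjoint.

open import Defs
open import Data.Fin using (Fin; zero; suc; punchIn; punchOut; _≟_)
open import Data.Fin.Properties using (all?; any?; punchIn-injective; punchInᵢ≢i; punchIn-punchOut)
open import Data.Fin.Subset using (Subset; Side; inside; outside; _∈_; _∉_; ∣_∣)
open import Data.Fin.Subset.Properties using (_∈?_; anySubset?; drop-there)
open import Data.List using ([]; _∷_)
open import Data.List.Relation.Unary.All using (All; []; _∷_)
open import Data.List.Relation.Unary.AllPairs using ([]; _∷_)
open import Data.List.Relation.Unary.Unique.Propositional using (Unique)
open import Data.Nat using (ℕ; zero; suc; _+_; _≤_; _<_; z≤n; s≤s; _<?_)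
open import Data.Nat.Induction using (<-wellFounded; Acc; acc)
open import Data.Nat.Properties using (≤-refl; ≤-reflexive; ≤-trans; ≤-antisym; ≤-pred; <⇒≤; <⇒≱; ≮⇒≥; ≤∧≢⇒<; ≤-<-trans; <-irrefl; +-comm)
open import Data.Product using (_×_; _,_; ∃-syntax; proj₁; proj₂)
open import Data.Sum using (_⊎_; inj₁; inj₂; [_,_]′)
open import Data.Vec using (_∷_; here; there; insertAt; removeAt; lookup)
open import Data.Vec.Properties using ([]=⇒lookup; lookup⇒[]=; insertAt-lookup; insertAt-punchIn; insertAt-removeAt)
open import Function using (_∘_; id)
open import Function.Bundles using (_⇔_; mk⇔)
open import Relation.Binary.PropositionalEquality using (_≡_; _≢_; refl; sym; trans; cong; subst; ≢-sym)
open import Relation.Nullary using (¬_; Dec; yes; no; contradiction)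
open import Relation.Nullary.Decidable using (map′; _×-dec_; _→-dec_; _⊎-dec_; ¬?)

module _ {A : Set} where

  unique₄ : ∀ {a b c d : A} → a ≢ b → a ≢ c → a ≢ d → b ≢ c → b ≢ d → c ≢ d →
            Unique (a ∷ b ∷ c ∷ d ∷ [])
  unique₄ ab ac ad bc bd cd =
    (ab ∷ ac ∷ ad ∷ []) ∷ (bc ∷ bd ∷ []) ∷ (cd ∷ []) ∷ [] ∷ []

-- Short distances, friendly edges and contractible pairs

module _ {n : ℕ} (G : Graph n) where

  -- Distance at most two without minimality and with coincidence allowed: in this form it survives
  -- contraction, which may shorten paths or merge vertices.
  data Near (u v : Fin n) : Set where
    same : u ≡ v → Near u v
    edge : Adj G u v → Near u v
    via  : ∀ w → Adj G u w → Adj G w v → Near u v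

  OrientedFriendlyEdge : Subset n → Fin n → Fin n → Set
  OrientedFriendlyEdge D x y =
    x ∈ D × y ∈ D × Adj G x y × ∃[ z ] (z ∈ D × z ≢ x × z ≢ y × Near y z)

  -- Contraction forgets which end is close to the third vertex, so this form is symmetric in the
  -- ends; `orient` restores a direction.
  FriendlyEdge : Subset n → Fin n → Fin n → Set
  FriendlyEdge D x y =
    x ∈ D × y ∈ D × Adj G x y ×
    ∃[ z ] (z ∈ D × z ≢ x × z ≢ y × (Near x z ⊎ Near y z))

  -- The pairs of edges inside D whose contraction keeps the image of D
  -- semitotal: either the two edges share the vertex b or they are disjoint.
  data ContractiblePair (D : Subset n) : Set where
    path : ∀ a b c d → Unique (a ∷ b ∷ c ∷ d ∷ []) → All (_∈ D) (a ∷ b ∷ c ∷ d ∷ []) →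
           Adj G a b → Adj G b c → Near a d ⊎ Near b d ⊎ Near c d →
           ContractiblePair D
    disjoint : ∀ a b c d → a ≢ c → a ≢ d → b ≢ c → b ≢ d →
               FriendlyEdge D a b → FriendlyEdge D c d → ContractiblePair D

-- Decidability and existence of the semitotal domination number

module _ {n : ℕ} {G : Graph n} where

  near-sym : ∀ {u v} → Near G u v → Near G v u
  near-sym (same e)    = same (sym e)
  near-sym (edge a)    = edge (Graph.sym G a)
  near-sym (via w a b) = via w (Graph.sym G b) (Graph.sym G a)

  near? : ∀ u v → Dec (Near G u v)
  near? u v = map′ to from
    ((u ≟ v) ⊎-dec Graph.adj? G u v ⊎-dec any? λ w → Graph.adj? G u w ×-dec Graph.adj? G w v)
    where
    to : u ≡ v ⊎ Adj G u v ⊎ ∃[ w ] (Adj G u w × Adj G w v) → Near G u v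
    to (inj₁ e)                    = same e
    to (inj₂ (inj₁ a))             = edge a
    to (inj₂ (inj₂ (w , a , b)))   = via w a b
    from : Near G u v → u ≡ v ⊎ Adj G u v ⊎ ∃[ w ] (Adj G u w × Adj G w v)
    from (same e)    = inj₁ e
    from (edge a)    = inj₂ (inj₁ a)
    from (via w a b) = inj₂ (inj₂ (w , a , b))

  near-cases : ∀ {u v} → u ≢ v → Near G u v → Adj G u v ⊎ Dist G u v 2
  near-cases u≢v (same e) = contradiction e u≢v
  near-cases u≢v (edge a) = inj₁ a
  near-cases {u} {v} u≢v (via w a b) with Graph.adj? G u v
  ... | yes e = inj₁ e
  ... | no ¬e = inj₂ (a ∷ b ∷ [] , least)
    where
    least : ∀ j → Walk G u v j → 2 ≤ j
    least _ []          = contradiction refl u≢v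
    least _ (e ∷ [])    = contradiction e ¬e
    least _ (_ ∷ _ ∷ _) = s≤s (s≤s z≤n)

  near⇒dist≤2 : ∀ {u v} → Near G u v → Dist≤ G u v 2
  near⇒dist≤2 {u} {v} p with u ≟ v
  ... | yes refl = 0 , ([] , λ _ _ → z≤n) , z≤n
  ... | no u≢v with near-cases u≢v p
  ...   | inj₂ d = 2 , d , ≤-refl
  ...   | inj₁ a = 1 , (a ∷ [] , least) , s≤s z≤n
    where
    least : ∀ j → Walk G u v j → 1 ≤ j
    least _ []      = contradiction refl u≢v
    least _ (_ ∷ _) = s≤s z≤n

  dist≤2⇒near : ∀ {u v} → Dist≤ G u v 2 → Near G u v
  dist≤2⇒near (_ , ([] , _) , _)                  = same refl
  dist≤2⇒near (_ , (a ∷ [] , _) , _)              = edge a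
  dist≤2⇒near (_ , (a ∷ b ∷ [] , _) , _)          = via _ a b
  dist≤2⇒near (_ , (_ ∷ _ ∷ _ ∷ _ , _) , s≤s (s≤s ()))

  dist2⇒near : ∀ {u v} → Dist G u v 2 → Near G u v
  dist2⇒near d = dist≤2⇒near (2 , d , ≤-refl)

  NearSemitotal : Subset n → Set
  NearSemitotal D = ∀ v → v ∈ D → ∃[ w ] (w ∈ D × w ≢ v × Near G v w)

  near-semitotal : ∀ {D} → SemitotalDominating G D → NearSemitotal D
  near-semitotal std v v∈D =
    let w , w∈D , w≢v , d = SemitotalDominating.semitotal std v v∈D
    in w , w∈D , w≢v , dist≤2⇒near d

  fromNear : ∀ {D} → (∀ v → v ∉ D → ∃[ w ] (w ∈ D × Adj G v w)) → NearSemitotal D →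
             SemitotalDominating G D
  fromNear dom semi = record
    { dominating = dom
    ; semitotal  = λ v v∈D →
        let w , w∈D , w≢v , p = semi v v∈D in w , w∈D , w≢v , near⇒dist≤2 p
    }

  semitotalDominating? : ∀ D → Dec (SemitotalDominating G D)
  semitotalDominating? D = map′ (λ (d , s) → fromNear d s)
    (λ std → SemitotalDominating.dominating std , near-semitotal std)
    ((all? λ v → ¬? (v ∈? D) →-dec any? λ w → (w ∈? D) ×-dec Graph.adj? G v w)
     ×-dec
     (all? λ v → (v ∈? D) →-dec any? λ w → (w ∈? D) ×-dec ¬? (w ≟ v) ×-dec near? v w))

  -- `_<γt2_` demands exact values, so a small set has to be turned into a minimum one. Decidability
  -- of semitotal domination lets the search descend on size until no smaller set exists.
  γt2-exists : ∀ {D} → SemitotalDominating G D → ∃[ h ] (γt2 G h × h ≤ ∣ D ∣)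
  γt2-exists {D} std = search D std (<-wellFounded ∣ D ∣)
    where
    search : ∀ D → SemitotalDominating G D → Acc _<_ ∣ D ∣ → ∃[ h ] (γt2 G h × h ≤ ∣ D ∣)
    search D std (acc rec)
      with anySubset? (λ E → semitotalDominating? E ×-dec (∣ E ∣ <? ∣ D ∣))
    ... | yes (E , stdE , E<D) =
      let h , γ , h≤E = search E stdE (rec E<D) in h , γ , ≤-trans h≤E (<⇒≤ E<D)
    ... | no none = ∣ D ∣ , ((D , std , refl) , least) , ≤-refl
      where
      least : ∀ j → ∃[ E ] (SemitotalDominating G E × ∣ E ∣ ≡ j) → ∣ D ∣ ≤ j
      least _ (E , stdE , refl) = ≮⇒≥ λ E<D → none (E , stdE , E<D)

  γt2-unique : ∀ {g h} → γt2 G g → γt2 G h → g ≡ h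
  γt2-unique (Pg , g≤) (Ph , h≤) = ≤-antisym (g≤ _ Ph) (h≤ _ Pg)

  orient : ∀ {D x y} → FriendlyEdge G D x y →
           OrientedFriendlyEdge G D x y ⊎ OrientedFriendlyEdge G D y x
  orient (x∈ , y∈ , xy , z , z∈ , z≢x , z≢y , inj₁ p) =
    inj₂ (y∈ , x∈ , Graph.sym G xy , z , z∈ , z≢y , z≢x , p)
  orient (x∈ , y∈ , xy , z , z∈ , z≢x , z≢y , inj₂ p) =
    inj₁ (x∈ , y∈ , xy , z , z∈ , z≢x , z≢y , p)

  friendlyEdge⇒triple : ∀ {D x y} → FriendlyEdge G D x y → ContainsFriendlyTriple G D
  friendlyEdge⇒triple F = [ triple , triple ]′ (orient F)
    where
    triple : ∀ {D x y} → OrientedFriendlyEdge G D x y → ContainsFriendlyTriple G D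
    triple (x∈ , y∈ , xy , z , z∈ , z≢x , z≢y , p) =
      _ , _ , z ,
      (adj⇒≢ G xy ∷ ≢-sym z≢x ∷ []) ∷ (≢-sym z≢y ∷ []) ∷ [] ∷ [] ,
      x∈ ∷ y∈ ∷ z∈ ∷ [] , xy , near⇒dist≤2 p

  triple⇒friendlyEdge : ∀ {D} → ContainsFriendlyTriple G D → ∃[ x ] ∃[ y ] FriendlyEdge G D x y
  triple⇒friendlyEdge
    (x , y , z , (_ ∷ x≢z ∷ []) ∷ (y≢z ∷ []) ∷ [] ∷ [] , x∈ ∷ y∈ ∷ z∈ ∷ [] , xy , d) =
    x , y , x∈ , y∈ , xy , z , z∈ , ≢-sym x≢z , ≢-sym y≢z , inj₂ (dist≤2⇒near d)

  -- ST-configurations and contractible pairs of edges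

  -- O4, O5 and O6 are paths of two edges with a fourth vertex nearby; the others are disjoint
  -- friendly edges. O3 tolerates `c` equal to `f` because the two edges may share their third
  -- vertex.
  configuration⇒pair : ∀ {D} → ContainsSTConfiguration G D → ContractiblePair G D
  configuration⇒pair
    (O1 a b c d e f
      ((_ ∷ a≢c ∷ a≢d ∷ a≢e ∷ _) ∷ (b≢c ∷ b≢d ∷ b≢e ∷ _) ∷ _ ∷ (_ ∷ d≢f ∷ []) ∷ (e≢f ∷ []) ∷ _)
      (a∈ ∷ b∈ ∷ c∈ ∷ d∈ ∷ e∈ ∷ f∈ ∷ []) ab bc de ef) =
    disjoint a b d e a≢d a≢e b≢d b≢e
      (a∈ , b∈ , ab , c , c∈ , ≢-sym a≢c , ≢-sym b≢c , inj₂ (edge bc))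
      (d∈ , e∈ , de , f , f∈ , ≢-sym d≢f , ≢-sym e≢f , inj₂ (edge ef))
  configuration⇒pair
    (O2 a b c d e f
      ((_ ∷ a≢c ∷ a≢d ∷ a≢e ∷ _) ∷ (b≢c ∷ b≢d ∷ b≢e ∷ _) ∷ _ ∷ (_ ∷ d≢f ∷ []) ∷ (e≢f ∷ []) ∷ _)
      (a∈ ∷ b∈ ∷ c∈ ∷ d∈ ∷ e∈ ∷ f∈ ∷ []) ab de ef bc) =
    disjoint a b d e a≢d a≢e b≢d b≢e
      (a∈ , b∈ , ab , c , c∈ , ≢-sym a≢c , ≢-sym b≢c , inj₂ (dist2⇒near bc))
      (d∈ , e∈ , de , f , f∈ , ≢-sym d≢f , ≢-sym e≢f , inj₂ (edge ef))
  configuration⇒pair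
    (O3 a b c d e f
      ((_ ∷ a≢c ∷ a≢d ∷ a≢e ∷ []) ∷ (b≢c ∷ b≢d ∷ b≢e ∷ []) ∷ _)
      (_ ∷ _ ∷ (_ ∷ d≢f ∷ []) ∷ (e≢f ∷ []) ∷ _)
      (a∈ ∷ b∈ ∷ c∈ ∷ d∈ ∷ e∈ ∷ f∈ ∷ []) ab de bc ef) =
    disjoint a b d e a≢d a≢e b≢d b≢e
      (a∈ , b∈ , ab , c , c∈ , ≢-sym a≢c , ≢-sym b≢c , inj₂ (dist2⇒near bc))
      (d∈ , e∈ , de , f , f∈ , ≢-sym d≢f , ≢-sym e≢f , inj₂ (dist2⇒near ef))
  configuration⇒pair
    (O4 a b c d ((a≢b ∷ a≢c ∷ a≢d ∷ []) ∷ (b≢c ∷ b≢d ∷ []) ∷ (c≢d ∷ []) ∷ _)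
      (a∈ ∷ b∈ ∷ c∈ ∷ d∈ ∷ []) ab ac ad) =
    path b a c d (unique₄ (≢-sym a≢b) b≢c b≢d a≢c a≢d c≢d) (b∈ ∷ a∈ ∷ c∈ ∷ d∈ ∷ [])
      (Graph.sym G ab) ac (inj₂ (inj₁ (edge ad)))
  configuration⇒pair (O5 a b c d distinct all∈ ab bc cd) =
    path a b c d distinct all∈ ab bc (inj₂ (inj₂ (dist2⇒near cd)))
  configuration⇒pair
    (O6 a b c d ((a≢b ∷ a≢c ∷ a≢d ∷ []) ∷ (b≢c ∷ b≢d ∷ []) ∷ (c≢d ∷ []) ∷ _)
      (a∈ ∷ b∈ ∷ c∈ ∷ d∈ ∷ []) ab bd bc) =
    path a b d c (unique₄ a≢b a≢d a≢c b≢d b≢c (≢-sym c≢d)) (a∈ ∷ b∈ ∷ d∈ ∷ c∈ ∷ [])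
      ab bd (inj₂ (inj₁ (dist2⇒near bc)))
  configuration⇒pair
    (O7 a b c d ((a≢b ∷ a≢c ∷ a≢d ∷ []) ∷ (b≢c ∷ b≢d ∷ []) ∷ _)
      (a∈ ∷ b∈ ∷ c∈ ∷ d∈ ∷ []) ab cd bc) =
    -- Each edge takes its third vertex from the other: `c` for `ab` and `b` for `cd`.
    disjoint a b c d a≢c a≢d b≢c b≢d
      (a∈ , b∈ , ab , c , c∈ , ≢-sym a≢c , ≢-sym b≢c , inj₂ (dist2⇒near bc))
      (c∈ , d∈ , cd , b , b∈ , b≢c , b≢d , inj₁ (near-sym (dist2⇒near bc)))

  -- If `d` is close to the middle `b`, the result is O4 or O6. If it is close to an end, it is
  -- either at distance exactly two, which is O5, or adjacent to that end and then within two of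
  -- `b`.
  path⇒configuration : ∀ {D} a b c d →
    Unique (a ∷ b ∷ c ∷ d ∷ []) → All (_∈ D) (a ∷ b ∷ c ∷ d ∷ []) →
    Adj G a b → Adj G b c → Near G a d ⊎ Near G b d ⊎ Near G c d →
    ContainsSTConfiguration G D
  path⇒configuration a b c d
    ((a≢b ∷ a≢c ∷ a≢d ∷ []) ∷ (b≢c ∷ b≢d ∷ []) ∷ (c≢d ∷ []) ∷ _)
    (a∈ ∷ b∈ ∷ c∈ ∷ d∈ ∷ []) ab bc = λ where
      (inj₁ p)        → end a≢b a≢c a≢d b≢c b≢d c≢d a∈ b∈ c∈ d∈ ab bc p
      (inj₂ (inj₁ p)) → middle a≢b a≢c a≢d b≢c b≢d c≢d a∈ b∈ c∈ d∈ ab bc p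
      (inj₂ (inj₂ p)) → end (≢-sym b≢c) (≢-sym a≢c) c≢d (≢-sym a≢b) b≢d a≢d
                          c∈ b∈ a∈ d∈ (Graph.sym G bc) (Graph.sym G ab) p
    where
    middle : ∀ {D a b c d} → a ≢ b → a ≢ c → a ≢ d → b ≢ c → b ≢ d → c ≢ d →
      a ∈ D → b ∈ D → c ∈ D → d ∈ D → Adj G a b → Adj G b c → Near G b d →
      ContainsSTConfiguration G D
    middle a≢b a≢c a≢d b≢c b≢d c≢d a∈ b∈ c∈ d∈ ab bc p with near-cases b≢d p
    ... | inj₁ bd = O4 _ _ _ _ (unique₄ (≢-sym a≢b) b≢c b≢d a≢c a≢d c≢d)
                      (b∈ ∷ a∈ ∷ c∈ ∷ d∈ ∷ []) (Graph.sym G ab) bc bd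
    ... | inj₂ bd = O6 _ _ _ _ (unique₄ a≢b a≢d a≢c b≢d b≢c (≢-sym c≢d))
                      (a∈ ∷ b∈ ∷ d∈ ∷ c∈ ∷ []) ab bc bd
    end : ∀ {D a b c d} → a ≢ b → a ≢ c → a ≢ d → b ≢ c → b ≢ d → c ≢ d →
      a ∈ D → b ∈ D → c ∈ D → d ∈ D → Adj G a b → Adj G b c → Near G a d →
      ContainsSTConfiguration G D
    end a≢b a≢c a≢d b≢c b≢d c≢d a∈ b∈ c∈ d∈ ab bc p with near-cases a≢d p
    ... | inj₁ ad = middle a≢b a≢c a≢d b≢c b≢d c≢d a∈ b∈ c∈ d∈ ab bc
                      (via _ (Graph.sym G ab) ad)
    ... | inj₂ ad = O5 _ _ _ _ (unique₄ (≢-sym b≢c) (≢-sym a≢c) c≢d (≢-sym a≢b) b≢d a≢d)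
                      (c∈ ∷ b∈ ∷ a∈ ∷ d∈ ∷ []) (Graph.sym G bc) (Graph.sym G ab) ad

  nearEdges⇒configuration : ∀ {D a b c d} → a ≢ c → a ≢ d → b ≢ c → b ≢ d →
    All (_∈ D) (a ∷ b ∷ c ∷ d ∷ []) → Adj G a b → Adj G c d → Near G b c →
    ContainsSTConfiguration G D
  nearEdges⇒configuration a≢c a≢d b≢c b≢d all∈ ab cd p with near-cases b≢c p
  ... | inj₁ bc = path⇒configuration _ _ _ _
                    (unique₄ (adj⇒≢ G ab) a≢c a≢d b≢c b≢d (adj⇒≢ G cd))
                    all∈ ab bc (inj₂ (inj₂ (edge cd)))
  ... | inj₂ bc = O7 _ _ _ _ (unique₄ (adj⇒≢ G ab) a≢c a≢d b≢c b≢d (adj⇒≢ G cd))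
                    all∈ ab cd bc

  -- A third vertex lying on the other edge puts the two edges close together. Otherwise each third
  -- vertex is adjacent or at distance exactly two, which selects among O1, O2 and O3.
  orientedDisjoint⇒configuration : ∀ {D} a b d e → a ≢ d → a ≢ e → b ≢ d → b ≢ e →
    OrientedFriendlyEdge G D a b → OrientedFriendlyEdge G D d e → ContainsSTConfiguration G D
  orientedDisjoint⇒configuration a b d e a≢d a≢e b≢d b≢e
    (a∈ , b∈ , ab , c , c∈ , c≢a , c≢b , bc) (d∈ , e∈ , de , f , f∈ , f≢d , f≢e , ef)
    with c ≟ d | c ≟ e | f ≟ a | f ≟ b
  ... | yes refl | _ | _ | _ =
    nearEdges⇒configuration a≢d a≢e b≢d b≢e (a∈ ∷ b∈ ∷ d∈ ∷ e∈ ∷ []) ab de bc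
  ... | no _ | yes refl | _ | _ =
    nearEdges⇒configuration a≢e a≢d b≢e b≢d (a∈ ∷ b∈ ∷ e∈ ∷ d∈ ∷ []) ab (Graph.sym G de) bc
  ... | no _ | no _ | yes refl | _ =
    nearEdges⇒configuration (≢-sym a≢d) (≢-sym b≢d) (≢-sym a≢e) (≢-sym b≢e)
      (d∈ ∷ e∈ ∷ a∈ ∷ b∈ ∷ []) de ab ef
  ... | no _ | no _ | no _ | yes refl =
    nearEdges⇒configuration (≢-sym b≢d) (≢-sym a≢d) (≢-sym b≢e) (≢-sym a≢e)
      (d∈ ∷ e∈ ∷ b∈ ∷ a∈ ∷ []) de (Graph.sym G ab) ef
  ... | no c≢d | no c≢e | no f≢a | no f≢b
    with near-cases (≢-sym c≢b) bc | near-cases (≢-sym f≢e) ef | c ≟ f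
  ... | inj₂ bc₂ | inj₂ ef₂ | _ =
    O3 a b c d e f
      ((adj⇒≢ G ab ∷ ≢-sym c≢a ∷ a≢d ∷ a≢e ∷ []) ∷ (≢-sym c≢b ∷ b≢d ∷ b≢e ∷ []) ∷
       (c≢d ∷ c≢e ∷ []) ∷ (adj⇒≢ G de ∷ []) ∷ [] ∷ [])
      ((adj⇒≢ G ab ∷ a≢d ∷ a≢e ∷ ≢-sym f≢a ∷ []) ∷ (b≢d ∷ b≢e ∷ ≢-sym f≢b ∷ []) ∷
       (adj⇒≢ G de ∷ ≢-sym f≢d ∷ []) ∷ (≢-sym f≢e ∷ []) ∷ [] ∷ [])
      (a∈ ∷ b∈ ∷ c∈ ∷ d∈ ∷ e∈ ∷ f∈ ∷ []) ab de bc₂ ef₂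
  -- O1 and O2 forbid `c` equal to `f`, but a shared third vertex adjacent to `b` extends `ab` to a
  -- path with `e` close to its end `c`.
  ... | inj₁ bc₁ | _ | yes refl =
    path⇒configuration a b c e (unique₄ (adj⇒≢ G ab) (≢-sym c≢a) a≢e (≢-sym c≢b) b≢e c≢e)
      (a∈ ∷ b∈ ∷ c∈ ∷ e∈ ∷ []) ab bc₁ (inj₂ (inj₂ (near-sym ef)))
  ... | inj₂ _ | inj₁ ef₁ | yes refl =
    path⇒configuration d e f b
      (unique₄ (adj⇒≢ G de) (≢-sym f≢d) (≢-sym b≢d) (≢-sym f≢e) (≢-sym b≢e) f≢b)
      (d∈ ∷ e∈ ∷ f∈ ∷ b∈ ∷ []) de ef₁ (inj₂ (inj₂ (near-sym bc)))
  ... | inj₁ bc₁ | inj₁ ef₁ | no c≢f =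
    O1 a b c d e f
      ((adj⇒≢ G ab ∷ ≢-sym c≢a ∷ a≢d ∷ a≢e ∷ ≢-sym f≢a ∷ []) ∷
       (≢-sym c≢b ∷ b≢d ∷ b≢e ∷ ≢-sym f≢b ∷ []) ∷ (c≢d ∷ c≢e ∷ c≢f ∷ []) ∷
       (adj⇒≢ G de ∷ ≢-sym f≢d ∷ []) ∷ (≢-sym f≢e ∷ []) ∷ [] ∷ [])
      (a∈ ∷ b∈ ∷ c∈ ∷ d∈ ∷ e∈ ∷ f∈ ∷ []) ab bc₁ de ef₁
  ... | inj₂ bc₂ | inj₁ ef₁ | no c≢f =
    O2 a b c d e f
      ((adj⇒≢ G ab ∷ ≢-sym c≢a ∷ a≢d ∷ a≢e ∷ ≢-sym f≢a ∷ []) ∷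
       (≢-sym c≢b ∷ b≢d ∷ b≢e ∷ ≢-sym f≢b ∷ []) ∷ (c≢d ∷ c≢e ∷ c≢f ∷ []) ∷
       (adj⇒≢ G de ∷ ≢-sym f≢d ∷ []) ∷ (≢-sym f≢e ∷ []) ∷ [] ∷ [])
      (a∈ ∷ b∈ ∷ c∈ ∷ d∈ ∷ e∈ ∷ f∈ ∷ []) ab de ef₁ bc₂
  ... | inj₁ bc₁ | inj₂ ef₂ | no c≢f =
    O2 d e f a b c
      ((adj⇒≢ G de ∷ ≢-sym f≢d ∷ ≢-sym a≢d ∷ ≢-sym b≢d ∷ ≢-sym c≢d ∷ []) ∷
       (≢-sym f≢e ∷ ≢-sym a≢e ∷ ≢-sym b≢e ∷ ≢-sym c≢e ∷ []) ∷
       (f≢a ∷ f≢b ∷ ≢-sym c≢f ∷ []) ∷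
       (adj⇒≢ G ab ∷ ≢-sym c≢a ∷ []) ∷ (≢-sym c≢b ∷ []) ∷ [] ∷ [])
      (d∈ ∷ e∈ ∷ f∈ ∷ a∈ ∷ b∈ ∷ c∈ ∷ []) de ab bc₁ ef₂

  pair⇒configuration : ∀ {D} → ContractiblePair G D → ContainsSTConfiguration G D
  pair⇒configuration (path a b c d distinct all∈ ab bc p) =
    path⇒configuration a b c d distinct all∈ ab bc p
  pair⇒configuration (disjoint a b c d a≢c a≢d b≢c b≢d F F′) with orient F | orient F′
  ... | inj₁ E | inj₁ E′ = orientedDisjoint⇒configuration a b c d a≢c a≢d b≢c b≢d E E′
  ... | inj₁ E | inj₂ E′ = orientedDisjoint⇒configuration a b d c a≢d a≢c b≢d b≢c E E′
  ... | inj₂ E | inj₁ E′ = orientedDisjoint⇒configuration b a c d b≢c b≢d a≢c a≢d E E′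
  ... | inj₂ E | inj₂ E′ = orientedDisjoint⇒configuration b a d c b≢d b≢c a≢d a≢c E E′

-- Contraction of one edge: vertices, distances and subsets

∣insertAt∣ : ∀ {n} (p : Subset n) i s → ∣ insertAt p i s ∣ ≡ ∣ s ∷ p ∣
∣insertAt∣ p             zero    s       = refl
∣insertAt∣ (outside ∷ p) (suc i) outside = ∣insertAt∣ p i outside
∣insertAt∣ (outside ∷ p) (suc i) inside  = ∣insertAt∣ p i inside
∣insertAt∣ (inside ∷ p)  (suc i) outside = cong suc (∣insertAt∣ p i outside)
∣insertAt∣ (inside ∷ p)  (suc i) inside  = cong suc (∣insertAt∣ p i inside)

module Contraction {n : ℕ} (G : Graph (2 + n)) {u v : Fin (2 + n)} (uv : Adj G u v) where

  G/uv : Graph (suc n)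
  G/uv = contract G uv

  keep : Fin n → Fin (2 + n)
  keep = old G uv

  private
    v′ : Fin (suc n)
    v′ = punchOut (adj⇒≢ G uv)

    punchIn-v′ : punchIn u v′ ≡ v
    punchIn-v′ = punchIn-punchOut (adj⇒≢ G uv)

  keep≢u : ∀ i → keep i ≢ u
  keep≢u i = punchInᵢ≢i u _

  keep≢v : ∀ i → keep i ≢ v
  keep≢v i e = punchInᵢ≢i v′ i (punchIn-injective u _ _ (trans e (sym punchIn-v′)))

  keep-injective : ∀ {i j} → keep i ≡ keep j → i ≡ j
  keep-injective = punchIn-injective v′ _ _ ∘ punchIn-injective u _ _

  -- a ↦ p : the contraction sends the vertex a of G to the vertex p of G/uv.
  _↦_ : Fin (2 + n) → Fin (suc n) → Set
  a ↦ zero  = a ≡ u ⊎ a ≡ v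
  a ↦ suc i = a ≡ keep i

  ↦-total : ∀ a → ∃[ p ] (a ↦ p)
  ↦-total a with u ≟ a
  ... | yes refl = zero , inj₁ refl
  ... | no u≢a with v′ ≟ punchOut u≢a
  ...   | yes e = zero , inj₂ (trans (sym (punchIn-punchOut u≢a))
                                (trans (cong (punchIn u) (sym e)) punchIn-v′))
  ...   | no v′≢a′ = suc (punchOut v′≢a′) ,
                     sym (trans (cong (punchIn u) (punchIn-punchOut v′≢a′)) (punchIn-punchOut u≢a))

  keep≢merged : ∀ {i s} → s ↦ zero → keep i ≢ s
  keep≢merged (inj₁ refl) = keep≢u _
  keep≢merged (inj₂ refl) = keep≢v _

  ↦-functional : ∀ {a} p q → a ↦ p → a ↦ q → p ≡ q
  ↦-functional zero    zero    _    _  = refl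
  ↦-functional zero    (suc j) s    refl = contradiction refl (keep≢merged s)
  ↦-functional (suc i) zero    refl s  = contradiction refl (keep≢merged s)
  ↦-functional (suc i) (suc j) refl e  = cong suc (keep-injective e)

  ↦-suc : ∀ {a} → a ≢ u → a ≢ v → ∃[ i ] (a ≡ keep i)
  ↦-suc {a} a≢u a≢v with ↦-total a
  ... | zero  , inj₁ e = contradiction e a≢u
  ... | zero  , inj₂ e = contradiction e a≢v
  ... | suc i , e      = i , e

  ↦suc⇒≢ : ∀ {x z i} → x ≡ keep i → z ≢ x → ∀ r → z ↦ r → r ≢ suc i
  ↦suc⇒≢ x↦i z≢x _ z↦r refl = z≢x (trans z↦r (sym x↦i))

  -- Only `uv` itself can collapse to a point, hence the first alternative.
  adj-image : ∀ {a b} p q → a ↦ p → b ↦ q → Adj G a b → p ≡ q ⊎ Adj G/uv p q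
  adj-image zero    zero    _           _           _  = inj₁ refl
  adj-image zero    (suc j) (inj₁ refl) refl        ab = inj₂ (inj₁ ab)
  adj-image zero    (suc j) (inj₂ refl) refl        ab = inj₂ (inj₂ ab)
  adj-image (suc i) zero    refl        (inj₁ refl) ab = inj₂ (inj₁ (Graph.sym G ab))
  adj-image (suc i) zero    refl        (inj₂ refl) ab = inj₂ (inj₂ (Graph.sym G ab))
  adj-image (suc i) (suc j) refl        refl        ab = inj₂ ab

  near-image : ∀ {a b} p q → a ↦ p → b ↦ q → Near G a b → Near G/uv p q
  near-image p q a↦p b↦q (same refl) = same (↦-functional p q a↦p b↦q)
  near-image p q a↦p b↦q (edge ab) = [ same , edge ]′ (adj-image p q a↦p b↦q ab)
  near-image p q a↦p b↦q (via c ac cb) =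
    let r , c↦r = ↦-total c in
    compose (adj-image p r a↦p c↦r ac) (adj-image r q c↦r b↦q cb)
    where
    compose : ∀ {p r q} → p ≡ r ⊎ Adj G/uv p r → r ≡ q ⊎ Adj G/uv r q → Near G/uv p q
    compose (inj₁ refl) (inj₁ e)    = same e
    compose (inj₁ refl) (inj₂ rq)   = edge rq
    compose (inj₂ pr)   (inj₁ refl) = edge pr
    compose (inj₂ pr)   (inj₂ rq)   = via _ pr rq

  merged-adj : ∀ {a s} → a ↦ zero → s ↦ zero → a ≢ s → Adj G a s
  merged-adj (inj₁ refl) (inj₁ refl) a≢s = contradiction refl a≢s
  merged-adj (inj₁ refl) (inj₂ refl) _   = uv
  merged-adj (inj₂ refl) (inj₁ refl) _   = Graph.sym G uv
  merged-adj (inj₂ refl) (inj₂ refl) a≢s = contradiction refl a≢s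

  -- A neighbour of the new vertex is adjacent to one end of `uv` and reaches the other across that
  -- edge.
  near-merged : ∀ {s i} → s ↦ zero → Adj G/uv zero (suc i) → Near G (keep i) s
  near-merged (inj₁ refl) (inj₁ ui) = edge (Graph.sym G ui)
  near-merged (inj₁ refl) (inj₂ vi) = via v (Graph.sym G vi) (Graph.sym G uv)
  near-merged (inj₂ refl) (inj₁ ui) = via u (Graph.sym G ui) uv
  near-merged (inj₂ refl) (inj₂ vi) = edge (Graph.sym G vi)

  -- Only a path through the new vertex can fail to lift. Both of its ends are then close to
  -- whichever end `s` of `uv` is chosen.
  near-keep : ∀ {s i j} → s ↦ zero → Near G/uv (suc i) (suc j) →
              Near G (keep i) (keep j) ⊎ (Near G (keep i) s × Near G (keep j) s)
  near-keep s (same refl)         = inj₁ (same refl)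
  near-keep s (edge ij)           = inj₁ (edge ij)
  near-keep s (via zero iz zj)    = inj₂ (near-merged s iz , near-merged s zj)
  near-keep s (via (suc k) ik kj) = inj₁ (via (keep k) ik kj)

  near-new : ∀ {i} → Near G/uv zero (suc i) → Near G u (keep i) ⊎ Near G v (keep i)
  near-new (edge (inj₁ ui))           = inj₁ (edge ui)
  near-new (edge (inj₂ vi))           = inj₂ (edge vi)
  near-new (via (suc k) (inj₁ uk) ki) = inj₁ (via (keep k) uk ki)
  near-new (via (suc k) (inj₂ vk) ki) = inj₂ (via (keep k) vk ki)

  -- `s` and `t` decide whether `u` and `v` are selected, and `T` is the trace on the other
  -- vertices. The order of insertion mirrors `old`, so index `i` of `T` lands at `keep i`.
  expand : Side → Side → Subset n → Subset (2 + n)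
  expand s t T = insertAt (insertAt T v′ t) u s

  expand-surjective : ∀ D → ∃[ s ] ∃[ t ] ∃[ T ] (D ≡ expand s t T)
  expand-surjective D =
    lookup D u , lookup (removeAt D u) v′ , removeAt (removeAt D u) v′ ,
    sym (trans (cong (λ E → insertAt E u (lookup D u)) (insertAt-removeAt (removeAt D u) v′))
               (insertAt-removeAt D u))

  module _ (s t : Side) (T : Subset n) where

    lookup-expand-u : lookup (expand s t T) u ≡ s
    lookup-expand-u = insertAt-lookup (insertAt T v′ t) u s

    lookup-expand-v : lookup (expand s t T) v ≡ t
    lookup-expand-v = trans (cong (lookup (expand s t T)) (sym punchIn-v′))
      (trans (insertAt-punchIn (insertAt T v′ t) u s v′) (insertAt-lookup T v′ t))

    lookup-expand-keep : ∀ i → lookup (expand s t T) (keep i) ≡ lookup T i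
    lookup-expand-keep i =
      trans (insertAt-punchIn (insertAt T v′ t) u s (punchIn v′ i)) (insertAt-punchIn T v′ t i)

    keep∈expand⁺ : ∀ {i} → i ∈ T → keep i ∈ expand s t T
    keep∈expand⁺ {i} i∈T = lookup⇒[]= _ _ (trans (lookup-expand-keep i) ([]=⇒lookup i∈T))

    keep∈expand⁻ : ∀ {i} → keep i ∈ expand s t T → i ∈ T
    keep∈expand⁻ {i} ki∈ = lookup⇒[]= _ _ (trans (sym (lookup-expand-keep i)) ([]=⇒lookup ki∈))

    u∈expand⁻ : u ∈ expand s t T → s ≡ inside
    u∈expand⁻ u∈ = trans (sym lookup-expand-u) ([]=⇒lookup u∈)

    v∈expand⁻ : v ∈ expand s t T → t ≡ inside
    v∈expand⁻ v∈ = trans (sym lookup-expand-v) ([]=⇒lookup v∈)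

    ∣expand∣ : ∣ expand s t T ∣ ≡ ∣ s ∷ insertAt T v′ t ∣
    ∣expand∣ = ∣insertAt∣ (insertAt T v′ t) u s

  u∈expand⁺ : ∀ t T → u ∈ expand inside t T
  u∈expand⁺ t T = lookup⇒[]= _ _ (lookup-expand-u inside t T)

  v∈expand⁺ : ∀ s T → v ∈ expand s inside T
  v∈expand⁺ s T = lookup⇒[]= _ _ (lookup-expand-v s inside T)

  -- Pushing a semitotal dominating set forward

  record Image (D : Subset (2 + n)) : Set where
    field
      set        : Subset (suc n)
      ∣set∣      : ∣ D ∣ ≡ suc ∣ set ∣
      image∈     : ∀ {a} p → a ↦ p → a ∈ D → p ∈ set
      dominating : SemitotalDominating G/uv set

  -- Both `u` and `v` are in `D`, so merging them costs exactly one vertex. Domination and closeness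
  -- survive because contraction never lengthens a distance.
  image : ∀ {D} → SemitotalDominating G D → FriendlyEdge G D u v → Image D
  image {D} std F with expand-surjective D
  ... | s , t , T , refl with u∈expand⁻ s t T (proj₁ F) | v∈expand⁻ s t T (proj₁ (proj₂ F))
  ...   | refl | refl = record
    { set        = inside ∷ T
    ; ∣set∣      = trans (∣expand∣ inside inside T) (cong suc (∣insertAt∣ T v′ inside))
    ; image∈     = image∈
    ; dominating = fromNear dom semi
    }
    where
    D₀ = expand inside inside T

    image∈ : ∀ {a} p → a ↦ p → a ∈ D₀ → p ∈ inside ∷ T
    image∈ zero    _    _  = here
    image∈ (suc i) refl a∈ = there (keep∈expand⁻ inside inside T a∈)

    dom : ∀ p → p ∉ inside ∷ T → ∃[ q ] (q ∈ inside ∷ T × Adj G/uv p q)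
    dom zero    p∉ = contradiction here p∉
    dom (suc i) p∉ with SemitotalDominating.dominating std (keep i)
                          (p∉ ∘ there ∘ keep∈expand⁻ inside inside T)
    ... | w , w∈ , iw with ↦-total w
    ...   | q , w↦q with adj-image (suc i) q refl w↦q iw
    ...     | inj₁ refl = contradiction (image∈ (suc i) w↦q w∈) p∉
    ...     | inj₂ iq   = q , image∈ q w↦q w∈ , iq

    semi : NearSemitotal (inside ∷ T)
    -- `u` and `v` may have relied on each other; the third vertex of the friendly edge becomes the
    -- partner of the new vertex.
    semi zero _ =
      let _ , _ , _ , z , z∈ , z≢u , z≢v , p = F
          k , z↦k = ↦-suc z≢u z≢v
      in suc k , image∈ (suc k) z↦k z∈ , (λ ()) ,
         [ near-image zero (suc k) (inj₁ refl) z↦k , near-image zero (suc k) (inj₂ refl) z↦k ]′ p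
    semi (suc i) (there i∈) =
      let w , w∈ , w≢ , p = near-semitotal std (keep i) (keep∈expand⁺ inside inside T i∈)
          q , w↦q = ↦-total w
      in q , image∈ q w↦q w∈ , ↦suc⇒≢ refl w≢ q w↦q , near-image (suc i) q refl w↦q p

  -- The third vertex may be `u` or `v`; it then becomes the new vertex, still distinct from the
  -- images of `x` and `y`.
  disjoint-image : ∀ {D x y} (I : Image D) → u ≢ x → u ≢ y → v ≢ x → v ≢ y →
    FriendlyEdge G D x y → ∃[ p ] ∃[ q ] FriendlyEdge G/uv (Image.set I) p q
  disjoint-image I u≢x u≢y v≢x v≢y (x∈ , y∈ , xy , z , z∈ , z≢x , z≢y , near) =
    let i , x↦i = ↦-suc (≢-sym u≢x) (≢-sym v≢x)
        j , y↦j = ↦-suc (≢-sym u≢y) (≢-sym v≢y)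
        r , z↦r = ↦-total z
    in suc i , suc j ,
       Image.image∈ I (suc i) x↦i x∈ , Image.image∈ I (suc j) y↦j y∈ ,
       [ (λ e → contradiction e (↦suc⇒≢ y↦j (adj⇒≢ G xy) (suc i) x↦i)) , id ]′
         (adj-image (suc i) (suc j) x↦i y↦j xy) ,
       r , Image.image∈ I r z↦r z∈ , ↦suc⇒≢ x↦i z≢x r z↦r , ↦suc⇒≢ y↦j z≢y r z↦r ,
       [ inj₁ ∘ near-image (suc i) r x↦i z↦r , inj₂ ∘ near-image (suc j) r y↦j z↦r ]′ near

  -- The edge from `v` to `c` now starts at the new vertex, and `d` is its third vertex.
  path-image : ∀ {D c d} (I : Image D) → Unique (u ∷ v ∷ c ∷ d ∷ []) →
    All (_∈ D) (u ∷ v ∷ c ∷ d ∷ []) → Adj G v c → Near G u d ⊎ Near G v d ⊎ Near G c d →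
    ∃[ p ] ∃[ q ] FriendlyEdge G/uv (Image.set I) p q
  path-image {D} {c} {d} I
    ((_ ∷ u≢c ∷ u≢d ∷ []) ∷ (v≢c ∷ v≢d ∷ []) ∷ (c≢d ∷ []) ∷ _)
    (u∈ ∷ v∈ ∷ c∈ ∷ d∈ ∷ []) vc near =
    let k , c↦k = ↦-suc (≢-sym u≢c) (≢-sym v≢c)
        l , d↦l = ↦-suc (≢-sym u≢d) (≢-sym v≢d)
    in zero , suc k ,
       Image.image∈ I zero (inj₁ refl) u∈ , Image.image∈ I (suc k) c↦k c∈ ,
       [ (λ ()) , id ]′ (adj-image zero (suc k) (inj₂ refl) c↦k vc) ,
       suc l , Image.image∈ I (suc l) d↦l d∈ , (λ ()) ,
       ↦suc⇒≢ c↦k (≢-sym c≢d) (suc l) d↦l ,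
       [ inj₁ ∘ near-image zero (suc l) (inj₁ refl) d↦l
       , [ inj₁ ∘ near-image zero (suc l) (inj₂ refl) d↦l
         , inj₂ ∘ near-image (suc k) (suc l) c↦k d↦l ]′ ]′ near

  -- Pulling a semitotal dominating set back

  -- `friendly` serves a single contraction. `pair` serves the first of two: the friendly edge of
  -- the second contraction is lifted and joined with an edge meeting `u` or `v`.
  record Preimage (D′ : Subset (suc n)) : Set where
    field
      set        : Subset (2 + n)
      ∣set∣      : ∣ set ∣ ≡ suc ∣ D′ ∣
      dominating : SemitotalDominating G set
      friendly   : ∃[ x ] ∃[ y ] FriendlyEdge G set x y
      pair       : ∀ {x y} → FriendlyEdge G/uv D′ x y → ContractiblePair G set

  -- Shared by both cases of lifting: `D` agrees with `T` away from `uv` and contains an end `s`,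
  -- which dominates the other end. Partners of `u` and `v` are left to the caller.
  preimage-dominating : ∀ {b T D s} → SemitotalDominating G/uv (b ∷ T) → s ↦ zero → s ∈ D →
    (∀ {i} → i ∈ T → keep i ∈ D) → (∀ {i} → keep i ∈ D → i ∈ T) →
    (zero ∈ b ∷ T → u ∈ D × v ∈ D) →
    (∀ a → a ↦ zero → a ∈ D → ∃[ w ] (w ∈ D × w ≢ a × Near G a w)) →
    SemitotalDominating G D
  preimage-dominating {b} {T} {D} {s} std s↦ s∈ keep⁺ keep⁻ merged∈ merged-semi = fromNear dom semi
    where
    dom : ∀ a → a ∉ D → ∃[ w ] (w ∈ D × Adj G a w)
    dom a a∉ with ↦-total a
    ... | zero , a↦ = s , s∈ , merged-adj a↦ s↦ λ where refl → a∉ s∈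
    ... | suc i , refl
      with SemitotalDominating.dominating std (suc i) (a∉ ∘ keep⁺ ∘ drop-there)
    ...   | zero  , z∈ , inj₁ ui  = u , proj₁ (merged∈ z∈) , Graph.sym G ui
    ...   | zero  , z∈ , inj₂ vi  = v , proj₂ (merged∈ z∈) , Graph.sym G vi
    ...   | suc j , there j∈ , ij = keep j , keep⁺ j∈ , ij

    semi : NearSemitotal D
    semi a a∈ with ↦-total a
    ... | zero  , a↦ = merged-semi a a↦ a∈
    ... | suc i , refl with near-semitotal std (suc i) (there (keep⁻ a∈))
    -- The partner was the new vertex, so both ends are in `D`; the one that is close is taken.
    ...   | zero , z∈ , _ , p with near-new (near-sym p)
    ...     | inj₁ q = u , proj₁ (merged∈ z∈) , ≢-sym (keep≢u i) , near-sym q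
    ...     | inj₂ q = v , proj₂ (merged∈ z∈) , ≢-sym (keep≢v i) , near-sym q
    semi a a∈ | suc i , refl | suc j , there j∈ , j≢i , p with near-keep s↦ p
    ... | inj₁ q       = keep j , keep⁺ j∈ , j≢i ∘ cong suc ∘ keep-injective , q
    -- The path to the old partner ran through the new vertex, so `s` is close enough to replace
    -- that partner.
    ... | inj₂ (q , _) = s , s∈ , ≢-sym (keep≢merged s↦) , q

  -- If the new vertex is selected, replace it by both u and v.
  preimage-inside : ∀ {T} → SemitotalDominating G/uv (inside ∷ T) → Preimage (inside ∷ T)
  preimage-inside {T} std = record
    { set        = D
    ; ∣set∣      = trans (∣expand∣ inside inside T) (cong suc (∣insertAt∣ T v′ inside))
    ; dominating = preimage-dominating std (inj₁ refl) u∈ keep⁺ (keep∈expand⁻ inside inside T)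
                     (λ _ → u∈ , v∈)
                     (λ where
                       _ (inj₁ refl) _ → v , v∈ , ≢-sym (adj⇒≢ G uv) , edge uv
                       _ (inj₂ refl) _ → u , u∈ , adj⇒≢ G uv , edge (Graph.sym G uv))
    ; friendly   = u , v , friendly-uv
    ; pair       = [ pair , pair ]′ ∘ orient
    }
    where
    D = expand inside inside T

    u∈ : u ∈ D
    u∈ = u∈expand⁺ inside T

    v∈ : v ∈ D
    v∈ = v∈expand⁺ inside T

    keep⁺ : ∀ {i} → i ∈ T → keep i ∈ D
    keep⁺ = keep∈expand⁺ inside inside T

    -- The partner of the new vertex lies off `uv` and is close to one of its ends.
    friendly-uv : FriendlyEdge G D u v
    friendly-uv with near-semitotal std zero here
    ... | zero  , _ , 0≢0 , _        = contradiction refl 0≢0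
    ... | suc t , there t∈ , _ , p =
      u∈ , v∈ , uv , keep t , keep⁺ t∈ , keep≢u t , keep≢v t , near-new p

    -- An edge at the new vertex comes from `u` or `v`. That end becomes the middle of the path, the
    -- other its start.
    path-uv : ∀ {k l} → Adj G/uv zero (suc k) → k ∈ T → l ∈ T → suc l ≢ suc k →
      Near G u (keep l) ⊎ Near G v (keep l) ⊎ Near G (keep k) (keep l) → ContractiblePair G D
    path-uv {k} {l} (inj₂ vk) k∈ l∈ l≢k near =
      path u v (keep k) (keep l)
        (unique₄ (adj⇒≢ G uv) (≢-sym (keep≢u k)) (≢-sym (keep≢u l))
          (≢-sym (keep≢v k)) (≢-sym (keep≢v l)) (≢-sym (l≢k ∘ cong suc ∘ keep-injective)))
        (u∈ ∷ v∈ ∷ keep⁺ k∈ ∷ keep⁺ l∈ ∷ []) uv vk near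
    path-uv {k} {l} (inj₁ uk) k∈ l∈ l≢k near =
      path v u (keep k) (keep l)
        (unique₄ (≢-sym (adj⇒≢ G uv)) (≢-sym (keep≢v k)) (≢-sym (keep≢v l))
          (≢-sym (keep≢u k)) (≢-sym (keep≢u l)) (≢-sym (l≢k ∘ cong suc ∘ keep-injective)))
        (v∈ ∷ u∈ ∷ keep⁺ k∈ ∷ keep⁺ l∈ ∷ []) (Graph.sym G uv) uk
        ([ inj₂ ∘ inj₁ , [ inj₁ , inj₂ ∘ inj₂ ]′ ]′ near)

    disjoint-uv : ∀ {i j} → i ∈ T → j ∈ T → Adj G (keep i) (keep j) →
      ∃[ z ] (z ∈ D × z ≢ keep i × z ≢ keep j × Near G (keep j) z) → ContractiblePair G D
    disjoint-uv {i} {j} i∈ j∈ ij (z , z∈ , z≢i , z≢j , p) =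
      disjoint (keep i) (keep j) u v (keep≢u i) (keep≢v i) (keep≢u j) (keep≢v j)
        (keep⁺ i∈ , keep⁺ j∈ , ij , z , z∈ , z≢i , z≢j , inj₂ p) friendly-uv

    -- A friendly edge at the new vertex gives a path through `uv`; one avoiding it is disjoint from
    -- `uv`, which is itself friendly.
    pair : ∀ {x y} → OrientedFriendlyEdge G/uv (inside ∷ T) x y → ContractiblePair G D
    pair {zero} {suc j} (_ , there j∈ , xy , zero , _ , z≢x , _ , _) = contradiction refl z≢x
    pair {zero} {suc j} (_ , there j∈ , xy , suc l , there l∈ , _ , l≢j , p)
      with near-keep (inj₁ refl) p
    ... | inj₁ q       = path-uv xy j∈ l∈ l≢j (inj₂ (inj₂ q))
    ... | inj₂ (_ , q) = path-uv xy j∈ l∈ l≢j (inj₁ (near-sym q))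
    pair {suc i} {zero} (there i∈ , _ , xy , zero , _ , _ , z≢y , _) = contradiction refl z≢y
    pair {suc i} {zero} (there i∈ , _ , xy , suc l , there l∈ , l≢i , _ , p) =
      path-uv xy i∈ l∈ l≢i ([ inj₁ , inj₂ ∘ inj₁ ]′ (near-new p))
    pair {suc i} {suc j} (there i∈ , there j∈ , ij , zero , _ , _ , _ , p)
      with near-new (near-sym p)
    ... | inj₁ q = disjoint-uv i∈ j∈ ij (u , u∈ , ≢-sym (keep≢u i) , ≢-sym (keep≢u j) , near-sym q)
    ... | inj₂ q = disjoint-uv i∈ j∈ ij (v , v∈ , ≢-sym (keep≢v i) , ≢-sym (keep≢v j) , near-sym q)
    pair {suc i} {suc j} (there i∈ , there j∈ , ij , suc l , there l∈ , l≢i , l≢j , p)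
      with near-keep (inj₁ refl) p
    ... | inj₁ q       = disjoint-uv i∈ j∈ ij
      (keep l , keep⁺ l∈ , l≢i ∘ cong suc ∘ keep-injective , l≢j ∘ cong suc ∘ keep-injective , q)
    -- The path to the third vertex ran through the new vertex, so `u` stands in for it.
    ... | inj₂ (q , _) =
      disjoint-uv i∈ j∈ ij (u , u∈ , ≢-sym (keep≢u i) , ≢-sym (keep≢u j) , q)

  -- If the new vertex is not selected, it is dominated by a vertex w adjacent
  -- to an end s of the edge uv; then adding s suffices.
  preimage-outside : ∀ {T D s k} → SemitotalDominating G/uv (outside ∷ T) →
    s ↦ zero → Adj G s (keep k) → k ∈ T → s ∈ D →
    (∀ {i} → i ∈ T → keep i ∈ D) → (∀ {i} → keep i ∈ D → i ∈ T) →
    (∀ a → a ↦ zero → a ∈ D → a ≡ s) → ∣ D ∣ ≡ suc ∣ T ∣ → Preimage (outside ∷ T)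
  preimage-outside {T} {D} {s} {k} std s↦ sw k∈ s∈ keep⁺ keep⁻ only-s size = record
    { set        = D
    ; ∣set∣      = size
    ; dominating = preimage-dominating std s↦ s∈ keep⁺ keep⁻ (λ ()) λ a a↦ a∈ →
                     keep k , keep⁺ k∈ , keep≢merged a↦ ,
                     edge (subst (λ a → Adj G a (keep k)) (sym (only-s a a↦ a∈)) sw)
    ; friendly   = s , keep k , friendly-sw
    ; pair       = [ pair , pair ]′ ∘ orient
    }
    where
    keep≢ : ∀ {i j} → suc i ≢ suc j → keep i ≢ keep j
    keep≢ i≢j = i≢j ∘ cong suc ∘ keep-injective

    s≢keep : ∀ {i} → s ≢ keep i
    s≢keep = ≢-sym (keep≢merged s↦)

    -- The partner of `keep k` is the third vertex. If their path ran through the new vertex, it is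
    -- close to `s` instead.
    friendly-sw : FriendlyEdge G D s (keep k)
    friendly-sw with near-semitotal std (suc k) (there k∈)
    ... | suc t , there t∈ , t≢k , p =
      s∈ , keep⁺ k∈ , sw , keep t , keep⁺ t∈ , keep≢merged s↦ , keep≢ t≢k ,
      [ inj₂ , inj₁ ∘ near-sym ∘ proj₂ ]′ (near-keep s↦ p)

    -- The lifted edge is compared with the one from `s` to `keep k`: a common end gives a path
    -- starting at `s`, otherwise the two are disjoint.
    pair : ∀ {x y} → OrientedFriendlyEdge G/uv (outside ∷ T) x y → ContractiblePair G D
    pair {suc i} {suc j} (there i∈ , there j∈ , ij , suc l , there l∈ , l≢i , l≢j , p)
      with i ≟ k | j ≟ k
    ... | yes refl | _ =
      path s (keep i) (keep j) (keep l)
        (unique₄ s≢keep s≢keep s≢keep (adj⇒≢ G ij) (≢-sym (keep≢ l≢i)) (≢-sym (keep≢ l≢j)))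
        (s∈ ∷ keep⁺ i∈ ∷ keep⁺ j∈ ∷ keep⁺ l∈ ∷ []) sw ij
        ([ inj₂ ∘ inj₂ , inj₁ ∘ near-sym ∘ proj₂ ]′ (near-keep s↦ p))
    ... | no _ | yes refl =
      path s (keep j) (keep i) (keep l)
        (unique₄ s≢keep s≢keep s≢keep (≢-sym (adj⇒≢ G ij)) (≢-sym (keep≢ l≢j)) (≢-sym (keep≢ l≢i)))
        (s∈ ∷ keep⁺ j∈ ∷ keep⁺ i∈ ∷ keep⁺ l∈ ∷ []) sw (Graph.sym G ij)
        ([ inj₂ ∘ inj₁ , inj₁ ∘ near-sym ∘ proj₂ ]′ (near-keep s↦ p))
    ... | no i≢k | no j≢k =
      disjoint (keep i) (keep j) s (keep k)
        (keep≢merged s↦) (i≢k ∘ keep-injective) (keep≢merged s↦) (j≢k ∘ keep-injective)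
        (keep⁺ i∈ , keep⁺ j∈ , ij , third (near-keep s↦ p)) friendly-sw
      where
      third : Near G (keep j) (keep l) ⊎ (Near G (keep j) s × Near G (keep l) s) →
        ∃[ z ] (z ∈ D × z ≢ keep i × z ≢ keep j × (Near G (keep i) z ⊎ Near G (keep j) z))
      third (inj₁ q)       = keep l , keep⁺ l∈ , keep≢ l≢i , keep≢ l≢j , inj₂ q
      third (inj₂ (q , _)) = s , s∈ , s≢keep , s≢keep , inj₂ q

  preimage : ∀ {D′} → SemitotalDominating G/uv D′ → Preimage D′
  preimage {inside ∷ T}  std = preimage-inside std
  preimage {outside ∷ T} std with SemitotalDominating.dominating std zero (λ ())
  ... | suc k , there k∈ , inj₁ uk =
    preimage-outside std (inj₁ refl) uk k∈ (u∈expand⁺ outside T)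
      (keep∈expand⁺ inside outside T) (keep∈expand⁻ inside outside T)
      (λ where
        _ (inj₁ e)    _  → e
        _ (inj₂ refl) v∈ → contradiction (v∈expand⁻ inside outside T v∈) λ ())
      (trans (∣expand∣ inside outside T) (cong suc (∣insertAt∣ T v′ outside)))
  ... | suc k , there k∈ , inj₂ vk =
    preimage-outside std (inj₂ refl) vk k∈ (v∈expand⁺ outside T)
      (keep∈expand⁺ outside inside T) (keep∈expand⁻ outside inside T)
      (λ where
        _ (inj₁ refl) u∈ → contradiction (u∈expand⁻ outside inside T u∈) λ ()
        _ (inj₂ e)    _  → e)
      (trans (∣expand∣ outside inside T) (∣insertAt∣ T v′ inside))

-- Contracting one or two edges inside a given set

open Contraction using (image; path-image; disjoint-image; preimage; module Image; module Preimage)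

no-edge₁ : ∀ (G : Graph 1) x y → ¬ Adj G x y
no-edge₁ G zero zero e = Graph.irrefl G e

contract-friendlyEdge : ∀ {n} (G : Graph n) {D x y} → SemitotalDominating G D → FriendlyEdge G D x y →
  ∃[ m ] ∃[ H ] (Contracts 1 {m = m} G H × ∃[ D′ ] (SemitotalDominating H D′ × ∣ D ∣ ≡ suc ∣ D′ ∣))
contract-friendlyEdge {suc zero}    G std (_ , _ , xy , _) = contradiction xy (no-edge₁ G _ _)
contract-friendlyEdge {suc (suc n)} G std F@(_ , _ , xy , _) =
  let I = image G xy std F
  in _ , contract G xy , step xy done , Image.set I , Image.dominating I , Image.∣set∣ I

contract-pair : ∀ {n} (G : Graph n) {D} → SemitotalDominating G D → ContractiblePair G D →
  ∃[ m ] ∃[ H ] (Contracts 2 {m = m} G H × ∃[ D′ ] (SemitotalDominating H D′ × ∣ D ∣ ≡ 2 + ∣ D′ ∣))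
contract-pair {suc zero} G std (path _ _ _ _ _ _ ab _ _) = contradiction ab (no-edge₁ G _ _)
contract-pair {suc zero} G std (disjoint _ _ _ _ _ _ _ _ (_ , _ , ab , _) _) =
  contradiction ab (no-edge₁ G _ _)
contract-pair {suc (suc n)} G std
  (path a b c d distinct@((_ ∷ a≢c ∷ a≢d ∷ []) ∷ (b≢c ∷ _) ∷ _) all∈@(a∈ ∷ b∈ ∷ c∈ ∷ _) ab bc near) =
  -- `c` is the third vertex for `ab`; `d` is saved for the second contraction.
  let I = image G ab std (a∈ , b∈ , ab , c , c∈ , ≢-sym a≢c , ≢-sym b≢c , inj₂ (edge bc))
      _ , _ , F = path-image G ab I distinct all∈ bc near
      m , H , C , D″ , std″ , size = contract-friendlyEdge (contract G ab) (Image.dominating I) F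
  in m , H , step ab C , D″ , std″ , trans (Image.∣set∣ I) (cong suc size)
contract-pair {suc (suc n)} G std
  (disjoint a b c d a≢c a≢d b≢c b≢d F@(_ , _ , ab , _) F′) =
  let I = image G ab std F
      _ , _ , F″ = disjoint-image G ab I a≢c a≢d b≢c b≢d F′
      m , H , C , D″ , std″ , size = contract-friendlyEdge (contract G ab) (Image.dominating I) F″
  in m , H , step ab C , D″ , std″ , trans (Image.∣set∣ I) (cong suc size)

smaller-set⇒<γt2 : ∀ {m n} {H : Graph m} {G : Graph n} {D′ g} →
  SemitotalDominating H D′ → γt2 G g → ∣ D′ ∣ < g → H <γt2 G
smaller-set⇒<γt2 std γG D′<g =
  let h , γH , h≤D′ = γt2-exists std in h , _ , γH , γG , ≤-<-trans h≤D′ D′<g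

<γt2-irrefl : ∀ {n} {G : Graph n} → ¬ (G <γt2 G)
<γt2-irrefl (h , g , γh , γg , h<g) = <-irrefl (γt2-unique γh γg) h<g

-- Contraction numbers one and two

module _ {n : ℕ} (G : Graph n) where

  HasFriendlyMinimum : Set
  HasFriendlyMinimum = ∃[ D ] (MinSemitotalDominating G D × ContainsFriendlyTriple G D)

  friendly-minimum : ∀ {D g x y} → SemitotalDominating G D → γt2 G g → ∣ D ∣ ≡ g →
    FriendlyEdge G D x y → HasFriendlyMinimum
  friendly-minimum std γg refl F = _ , (std , γg) , friendlyEdge⇒triple F

  -- Lifting adds one vertex to a set smaller than `g`, so the result has at most, and by minimality
  -- exactly, `g` vertices.
  lower-by-one : ∀ {m} {H : Graph m} → Contracts 1 G H → H <γt2 G → HasFriendlyMinimum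
  lower-by-one (step uv done) (_ , g , ((D′ , std′ , refl) , _) , γg , D′<g) =
    let P = preimage _ uv std′
        D≤g = ≤-trans (≤-reflexive (Preimage.∣set∣ P)) D′<g
        _ , _ , F = Preimage.friendly P
    in friendly-minimum (Preimage.dominating P) γg
         (≤-antisym D≤g (proj₂ γg _ (_ , Preimage.dominating P , refl))) F

  friendly⇒ct₁ : HasFriendlyMinimum → ct G 1
  friendly⇒ct₁ (D , (std , γD) , triple) =
    let _ , _ , F = triple⇒friendlyEdge triple
        m , H , C , D′ , std′ , size = contract-friendlyEdge G std F
    in (m , H , C , smaller-set⇒<γt2 std′ γD (≤-reflexive (sym size))) , least
    where
    least : ∀ j → ∃[ m ] ∃[ H ] (Contracts j {m = m} G H × H <γt2 G) → 1 ≤ j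
    least zero    (_ , _ , done , G<G) = contradiction G<G <γt2-irrefl
    least (suc j) _                    = s≤s z≤n

  -- Lifting twice gives at most `g + 1` vertices. The lifted set contains a friendly triple, so
  -- `¬friendly` excludes size `g`.
  lower-by-two : ∀ {m} {H : Graph m} → ¬ HasFriendlyMinimum → Contracts 2 G H → H <γt2 G →
    ∃[ D ] ∃[ g ] (SemitotalDominating G D × γt2 G g × ∣ D ∣ ≡ g + 1 × ContainsSTConfiguration G D)
  lower-by-two ¬friendly (step e (step f done)) (_ , g , ((D″ , std″ , refl) , _) , γg , D″<g) =
    let P′ = preimage _ f std″
        P  = preimage _ e (Preimage.dominating P′)
        std = Preimage.dominating P
        _ , _ , F  = Preimage.friendly P
        _ , _ , F′ = Preimage.friendly P′
        size = trans (Preimage.∣set∣ P) (cong suc (Preimage.∣set∣ P′))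
        g≤D = proj₂ γg _ (_ , std , refl)
        g<D = ≤∧≢⇒< g≤D λ g≡D → ¬friendly (friendly-minimum std γg (sym g≡D) F)
        D≤1+g = ≤-trans (≤-reflexive size) (s≤s D″<g)
    in Preimage.set P , g , std , γg , trans (≤-antisym D≤1+g g<D) (+-comm 1 g) ,
       pair⇒configuration (Preimage.pair P F′)

  -- Two contractions take `D` from `g + 1` to `g - 1` vertices, while a single one that lowered the
  -- number would produce a friendly minimum.
  configuration⇒ct₂ : ∀ {D g} → ¬ HasFriendlyMinimum → SemitotalDominating G D → γt2 G g →
    ∣ D ∣ ≡ g + 1 → ContainsSTConfiguration G D → ct G 2
  configuration⇒ct₂ {D} {g} ¬friendly std γg size conf =
    let m , H , C , D″ , std″ , size″ = contract-pair G std (configuration⇒pair conf)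
        1+g≡2+D″ = trans (+-comm 1 g) (trans (sym size) size″)
    in (m , H , C , smaller-set⇒<γt2 std″ γg (≤-pred (≤-reflexive (sym 1+g≡2+D″)))) , least
    where
    least : ∀ j → ∃[ m ] ∃[ H ] (Contracts j {m = m} G H × H <γt2 G) → 2 ≤ j
    least zero          (_ , _ , done , G<G) = contradiction G<G <γt2-irrefl
    least (suc zero)    (_ , _ , C , H<G)    = contradiction (lower-by-one C H<G) ¬friendly
    least (suc (suc j)) _                    = s≤s (s≤s z≤n)

theorem5 : ∀ {n : ℕ} (G : Graph n) → Connected G →
    (ct G 1 ⇔ (∃[ D ] (MinSemitotalDominating G D × ContainsFriendlyTriple G D)))
    ×
    (ct G 2 ⇔
    ((¬ (∃[ D ] (MinSemitotalDominating G D × ContainsFriendlyTriple G D)))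
    ×
    (∃[ D ] ∃[ g ] (SemitotalDominating G D × γt2 G g × ∣ D ∣ ≡ g + 1 × ContainsSTConfiguration G D))))
theorem5 G _ =
  mk⇔ (λ ((_ , _ , C , H<G) , _) → lower-by-one G C H<G) (friendly⇒ct₁ G) ,
  mk⇔ (λ ((_ , _ , C , H<G) , least) →
         -- A friendly minimum would let one contraction suffice, against the minimality of two.
         let ¬friendly = λ friendly →
               contradiction (least 1 (proj₁ (friendly⇒ct₁ G friendly))) (<⇒≱ ≤-refl)
         in ¬friendly , lower-by-two G ¬friendly C H<G)
      (λ (¬friendly , _ , _ , std , γg , size , conf) →
         configuration⇒ct₂ G ¬friendly std γg size conf)
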